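{- Let $G=(V,E)$ be a graph, let $U\subseteq V$ be a non-empty set, and let $v\notin V$ be a new vertex. For each $W\subseteq U$ define $$A_W=\begin{cases}x^{|W|} & \text{if } \bigcap_{w\in W}N_G(w)=\emptyset,\\ 0 & \text{otherwise.}\end{cases}$$ Then $$N(G_{U\rhd v},x)=N(G,x)+\sum_{\substack{W\subseteq U\\ W\neq\emptyset}}(-1)^{|W|+1}x(1+x)^{|\bigcap_{w\in W}N_G(w)|}+\sum_{\substack{W\subseteq U\\ W\neq\emptyset}}A_W.$$
   Context: All graphs are simple, finite and undirected. For a graph $G=(V,E)$ and $v\in V$, $N_G(v)=\{u\in V: \{u,v\}\in E\}$ is the open neighborhood of $v$. The neighborhood complex of $G$ is $\mathcal N(G)=\{A\subseteq V : \exists v\in V,\ A\subseteq N_G(v)\}$, and the neighborhood polynomial of $G$ is $N(G,x)=\sum_{A\in\mathcal N(G)}x^{|A|}$. For $U\subseteq V$ and a new vertex $v\notin V$, $G_{U\rhd v}=(V\cup\{v\},E\cup\{\{u,v\}: u\in U\})$ is the graph obtained from $G$ by adding $v$ and joining it to all vertices of $U$. -}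

module Defs where

open import Algebra.Bundles using (RawRing)
import Algebra.Definitions.RawSemiring as RawSemiringDefinitions
open import Data.Bool using (if_then_else_)
open import Data.Empty using (⊥)
open import Data.Fin using (Fin; zero; suc)
open import Data.Fin.Properties using (any?)
open import Data.Fin.Subset using (Subset; inside; outside; _∈_; _⊆_; ∣_∣; ⋂)
open import Data.Fin.Subset.Properties using (_∈?_; _⊆?_; nonempty?)
open import Data.Integer as ℤ using (ℤ; 0ℤ; 1ℤ)
open import Data.List using (List; []; _∷_; [_]; _++_; map; foldr; filter; allFin)
open import Data.Nat using (ℕ; zero; suc)
open import Data.Product using (∃-syntax)
open import Data.Vec using ([]; _∷_; tabulate)
open import Level using (0ℓ)
open import Relation.Binary using (Rel; Symmetric; Irreflexive)
import Relation.Binary as Binary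
open import Relation.Binary.PropositionalEquality using (_≡_; refl)
open import Relation.Nullary using (does; yes; no)
open import Relation.Nullary.Decidable using (_×-dec_; ¬?)
open import Relation.Unary using (Decidable)

private
  variable
    n : ℕ

-- The polynomial ring ℤ[x]: a list a₀ ∷ a₁ ∷ … represents a₀ + a₁ x + ⋯.
-- Trailing zeros are allowed, so equality is equality of all coefficients.

Poly : Set
Poly = List ℤ

coeff : Poly → ℕ → ℤ
coeff []      _       = 0ℤ
coeff (a ∷ _) zero    = a
coeff (_ ∷ p) (suc k) = coeff p k

_≈ᴾ_ : Rel Poly 0ℓ
p ≈ᴾ q = ∀ k → coeff p k ≡ coeff q k

_+ᴾ_ : Poly → Poly → Poly
[]      +ᴾ q       = q
(a ∷ p) +ᴾ []      = a ∷ p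
(a ∷ p) +ᴾ (b ∷ q) = a ℤ.+ b ∷ p +ᴾ q

_*ᴾ_ : Poly → Poly → Poly
[]      *ᴾ q = []
(a ∷ p) *ᴾ q = map (a ℤ.*_) q +ᴾ (0ℤ ∷ p *ᴾ q)

ℤ[x] : RawRing 0ℓ 0ℓ
ℤ[x] = record
  { Carrier = Poly
  ; _≈_     = _≈ᴾ_
  ; _+_     = _+ᴾ_
  ; _*_     = _*ᴾ_
  ; -_      = map (λ a → ℤ.- a)
  ; 0#      = []
  ; 1#      = [ 1ℤ ]
  }

open RawRing ℤ[x] public using (_≈_; _+_; _*_; -_; 0#; 1#; rawSemiring)
open RawSemiringDefinitions rawSemiring public using (_^_)

x : Poly
x = 0ℤ ∷ 1ℤ ∷ []

∑ : {A : Set} → List A → (A → Poly) → Poly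
∑ as f = foldr _+_ 0# (map f as)

infix 5 ∑
syntax ∑ as (λ a → e) = ∑[ a ∈ as ] e

subsets : ∀ n → List (Subset n)
subsets zero    = [ [] ]
subsets (suc n) = map (outside ∷_) (subsets n) ++ map (inside ∷_) (subsets n)

nonemptySubsetsOf : Subset n → List (Subset n)
nonemptySubsetsOf U = filter (λ W → (W ⊆? U) ×-dec nonempty? W) (subsets _)

record Graph (n : ℕ) : Set₁ where
  infix 4 _~_ _~?_
  field
    _~_    : Rel (Fin n) 0ℓ
    _~?_   : Binary.Decidable _~_
    sym    : Symmetric _~_
    irrefl : Irreflexive _≡_ _~_

module _ (G : Graph n) where
  open Graph G

  neighbours : Fin n → Subset n
  neighbours v = tabulate λ u → does (u ~? v)

  -- All of Fin n when W is empty.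
  commonNeighbours : Subset n → Subset n
  commonNeighbours W = ⋂ (map neighbours (filter (_∈? W) (allFin n)))

  NeighbourhoodComplex : Subset n → Set
  NeighbourhoodComplex A = ∃[ v ] A ⊆ neighbours v

  neighbourhoodComplex? : Decidable NeighbourhoodComplex
  neighbourhoodComplex? A = any? λ v → A ⊆? neighbours v

  neighbourhoodPolynomial : Poly
  neighbourhoodPolynomial =
    ∑[ A ∈ filter neighbourhoodComplex? (subsets n) ] (x ^ ∣ A ∣)

  A-term : Subset n → Poly
  A-term W = if does (¬? (nonempty? (commonNeighbours W))) then x ^ ∣ W ∣ else 0#

-- The graph G_{U ▷ v}: the new vertex v is zero, and the old vertex i
-- becomes suc i.
module _ (G : Graph n) (U : Subset n) where
  private module G = Graph G

  Adjacent : Rel (Fin (suc n)) 0ℓ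
  Adjacent zero    zero    = ⊥
  Adjacent zero    (suc j) = j ∈ U
  Adjacent (suc i) zero    = i ∈ U
  Adjacent (suc i) (suc j) = i G.~ j

  adjacent? : Binary.Decidable Adjacent
  adjacent? zero    zero    = no λ ()
  adjacent? zero    (suc j) = j ∈? U
  adjacent? (suc i) zero    = i ∈? U
  adjacent? (suc i) (suc j) = i G.~? j

  adjacent-sym : Symmetric Adjacent
  adjacent-sym {zero}  {suc j} p = p
  adjacent-sym {suc i} {zero}  p = p
  adjacent-sym {suc i} {suc j} p = G.sym p

  adjacent-irrefl : Irreflexive _≡_ Adjacent
  adjacent-irrefl {suc i} refl p = G.irrefl refl p

  addVertex : Graph (suc n)
  addVertex = record
    { _~_    = Adjacent
    ; _~?_   = adjacent?
    ; sym    = λ {i} {j} → adjacent-sym {i} {j}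
    ; irrefl = adjacent-irrefl
    }

{-# OPTIONS --safe #-}

-- Split the faces of 𝒩(G_{U ▷ v}) by whether they contain v.  A set A ⊆ V is a face iff A ∈ 𝒩(G)
-- or A ⊆ U; since A ∉ 𝒩(G) exactly when ⋂_{a ∈ A} N(a) = ∅, these faces contribute N(G, x) and
-- the terms A_W.  A set A ∪ {v} is a face iff S = U ∩ ⋂_{a ∈ A} N(a) is non-empty.  By Euler's
-- identity Σ_{∅ ≠ W ⊆ S} (-1)^(|W|+1) = [S ≠ ∅], and since A ⊆ ⋂_{w ∈ W} N(w) iff
-- W ⊆ ⋂_{a ∈ A} N(a), interchanging the sums over A and W leaves, for each W ⊆ U, the sum of
-- x^(|A|+1) over A ⊆ ⋂_{w ∈ W} N(w), which is x (1 + x)^|⋂_{w ∈ W} N(w)|.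

module Submission where

open import Defs hiding (_≈_; _+_; _*_; -_; 0#; 1#; rawSemiring; _^_; x; ∑)
open import Algebra.Bundles using (CommutativeMonoid; Ring; Semiring)
import Algebra.Definitions.RawSemiring as RawSemiringDefinitions
import Algebra.Properties.CommutativeSemigroup as CommutativeSemigroupProperties
import Algebra.Properties.Ring as RingProperties
open import Data.Bool using (if_then_else_)
open import Data.Fin using (Fin; zero; suc)
open import Data.Fin.Subset
  using (Subset; Nonempty; inside; outside; _∈_; _⊆_; _∩_; ⋂; ∣_∣)
open import Data.Fin.Subset.Properties
  using ( _∈?_; _⊆?_; nonempty?; ∈⊤; ⊆-trans; x∈p∩q⁺; x∈p∩q⁻; p∩q⊆p; p∩q⊆q
        ; out⊆; in⊆in; out⊆-⇔; in⊆in-⇔; drop-∷-⊆ )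
open import Data.Integer as ℤ using (ℤ; 0ℤ; 1ℤ)
import Data.Integer.Properties as ℤ
open import Data.Integer.Tactic.RingSolver using (solve-∀)
open import Data.List using (List; []; _∷_; _++_; map; foldr; filter; allFin)
open import Data.List.Membership.Propositional.Properties using (∈-allFin; ∈-filter⁺; ∈-filter⁻)
open import Data.List.Relation.Unary.All as All using (All; []; _∷_)
open import Data.Nat as ℕ using (ℕ; zero; suc)
import Data.Nat.Properties as ℕ
open import Data.Product using (_×_; _,_; proj₁; proj₂)
open import Data.Product.Function.NonDependent.Propositional using (_×-⇔_)
open import Data.Sum using (_⊎_; inj₁; inj₂; [_,_])
open import Data.Vec using ([]; _∷_; here; there)
open import Data.Vec.Properties using (lookup∘tabulate; []=⇒lookup; lookup⇒[]=)
open import Function using (_∘_; _⇔_; mk⇔; Equivalence)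
open import Level using (0ℓ; Level)
open import Relation.Binary.PropositionalEquality as ≡ using (_≡_; refl; cong; cong₂)
import Relation.Binary.Reasoning.Setoid as SetoidReasoning
open import Relation.Nullary using (Dec; does; yes; no; ¬_; contradiction)
open import Relation.Nullary.Decidable using (_×-dec_; ¬?; does-⇔; dec-true; dec-false)
open import Relation.Unary using (Pred; Decidable)

private
  variable
    n : ℕ
    a p : Level
    A B : Set a
    P Q S : Set p

open Equivalence using (to; from)

-- Lists differing by trailing zeros are equal polynomials, so the ring laws are proved for the
-- Cauchy product of coefficient sequences, of which _*ᴾ_ is an instance.
conv : (ℕ → ℤ) → (ℕ → ℤ) → ℕ → ℤ
conv f g zero    = f 0 ℤ.* g 0
conv f g (suc k) = f 0 ℤ.* g (suc k) ℤ.+ conv (f ∘ suc) g k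

conv-cong : ∀ {f f′ g g′} → (∀ k → f k ≡ f′ k) → (∀ k → g k ≡ g′ k) →
            ∀ k → conv f g k ≡ conv f′ g′ k
conv-cong f≗ g≗ zero    = cong₂ ℤ._*_ (f≗ 0) (g≗ 0)
conv-cong f≗ g≗ (suc k) =
  cong₂ ℤ._+_ (cong₂ ℤ._*_ (f≗ 0) (g≗ (suc k))) (conv-cong (f≗ ∘ suc) g≗ k)

conv-zeroˡ : ∀ g k → conv (λ _ → 0ℤ) g k ≡ 0ℤ
conv-zeroˡ g zero    = refl
conv-zeroˡ g (suc k) = ≡.trans (ℤ.+-identityˡ _) (conv-zeroˡ g k)

conv-distribʳ : ∀ f f′ g k →
  conv (λ i → f i ℤ.+ f′ i) g k ≡ conv f g k ℤ.+ conv f′ g k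
conv-distribʳ f f′ g zero    = ℤ.*-distribʳ-+ (g 0) (f 0) (f′ 0)
conv-distribʳ f f′ g (suc k) = ≡.trans
  (cong (ℤ._+_ ((f 0 ℤ.+ f′ 0) ℤ.* g (suc k))) (conv-distribʳ (f ∘ suc) (f′ ∘ suc) g k))
  (rearrange (f 0) (f′ 0) (g (suc k)) (conv (f ∘ suc) g k) (conv (f′ ∘ suc) g k))
  where
  rearrange : ∀ a b c d e → (a ℤ.+ b) ℤ.* c ℤ.+ (d ℤ.+ e) ≡ (a ℤ.* c ℤ.+ d) ℤ.+ (b ℤ.* c ℤ.+ e)
  rearrange = solve-∀

conv-distribˡ : ∀ f g g′ k →
  conv f (λ i → g i ℤ.+ g′ i) k ≡ conv f g k ℤ.+ conv f g′ k
conv-distribˡ f g g′ zero    = ℤ.*-distribˡ-+ (f 0) (g 0) (g′ 0)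
conv-distribˡ f g g′ (suc k) = ≡.trans
  (cong (ℤ._+_ (f 0 ℤ.* (g (suc k) ℤ.+ g′ (suc k)))) (conv-distribˡ (f ∘ suc) g g′ k))
  (rearrange (f 0) (g (suc k)) (g′ (suc k)) (conv (f ∘ suc) g k) (conv (f ∘ suc) g′ k))
  where
  rearrange : ∀ a b c d e → a ℤ.* (b ℤ.+ c) ℤ.+ (d ℤ.+ e) ≡ (a ℤ.* b ℤ.+ d) ℤ.+ (a ℤ.* c ℤ.+ e)
  rearrange = solve-∀

conv-scaleˡ : ∀ c f g k → conv (λ i → c ℤ.* f i) g k ≡ c ℤ.* conv f g k
conv-scaleˡ c f g zero    = ℤ.*-assoc c (f 0) (g 0)
conv-scaleˡ c f g (suc k) = ≡.trans
  (cong₂ ℤ._+_ (ℤ.*-assoc c (f 0) (g (suc k))) (conv-scaleˡ c (f ∘ suc) g k))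
  (≡.sym (ℤ.*-distribˡ-+ c _ _))

-- Induction on `k`. After its first term, `conv f g` is `f 0` times the shift of `g` plus
-- `conv (f ∘ suc) g`, so distributivity and scaling leave an instance of the induction hypothesis
-- at `f ∘ suc`.
conv-assoc : ∀ f g h k → conv (conv f g) h k ≡ conv f (conv g h) k
conv-assoc f g h zero    = ℤ.*-assoc (f 0) (g 0) (h 0)
conv-assoc f g h (suc k) = begin
  f 0 ℤ.* g 0 ℤ.* h (suc k) ℤ.+ conv (λ i → f 0 ℤ.* g (suc i) ℤ.+ conv (f ∘ suc) g i) h k
    ≡⟨ cong (ℤ._+_ (f 0 ℤ.* g 0 ℤ.* h (suc k))) (conv-distribʳ (λ i → f 0 ℤ.* g (suc i)) (conv (f ∘ suc) g) h k) ⟩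
  f 0 ℤ.* g 0 ℤ.* h (suc k) ℤ.+ (conv (λ i → f 0 ℤ.* g (suc i)) h k ℤ.+ conv (conv (f ∘ suc) g) h k)
    ≡⟨ cong (ℤ._+_ (f 0 ℤ.* g 0 ℤ.* h (suc k)))
         (cong₂ ℤ._+_ (conv-scaleˡ (f 0) (g ∘ suc) h k) (conv-assoc (f ∘ suc) g h k)) ⟩
  f 0 ℤ.* g 0 ℤ.* h (suc k) ℤ.+ (f 0 ℤ.* conv (g ∘ suc) h k ℤ.+ conv (f ∘ suc) (conv g h) k)
    ≡⟨ rearrange (f 0) (g 0) (h (suc k)) (conv (g ∘ suc) h k) (conv (f ∘ suc) (conv g h) k) ⟩
  f 0 ℤ.* (g 0 ℤ.* h (suc k) ℤ.+ conv (g ∘ suc) h k) ℤ.+ conv (f ∘ suc) (conv g h) k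
    ∎
  where
  open ≡.≡-Reasoning
  rearrange : ∀ a b c d e → a ℤ.* b ℤ.* c ℤ.+ (a ℤ.* d ℤ.+ e) ≡ a ℤ.* (b ℤ.* c ℤ.+ d) ℤ.+ e
  rearrange = solve-∀

conv-identityˡ : ∀ g k → conv (coeff (1ℤ ∷ [])) g k ≡ g k
conv-identityˡ g zero    = ℤ.*-identityˡ (g 0)
conv-identityˡ g (suc k) = ≡.trans
  (cong₂ ℤ._+_ (ℤ.*-identityˡ (g (suc k))) (conv-zeroˡ g k)) (ℤ.+-identityʳ _)

conv-identityʳ : ∀ f k → conv f (coeff (1ℤ ∷ [])) k ≡ f k
conv-identityʳ f zero    = ℤ.*-identityʳ (f 0)
conv-identityʳ f (suc k) = ≡.trans
  (cong₂ ℤ._+_ (ℤ.*-zeroʳ (f 0)) (conv-identityʳ (f ∘ suc) k)) (ℤ.+-identityˡ _)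

-- Coefficients of sums, negatives and products

coeff-+ : ∀ p q k → coeff (p +ᴾ q) k ≡ coeff p k ℤ.+ coeff q k
coeff-+ []      q       k       = ≡.sym (ℤ.+-identityˡ _)
coeff-+ (a ∷ p) []      k       = ≡.sym (ℤ.+-identityʳ _)
coeff-+ (a ∷ p) (b ∷ q) zero    = refl
coeff-+ (a ∷ p) (b ∷ q) (suc k) = coeff-+ p q k

-- Beyond the end of the list every coefficient is `0ℤ` by default and `map` does not act there, so
-- `f` has to fix `0ℤ`.
coeff-map : ∀ {f} → f 0ℤ ≡ 0ℤ → ∀ p k → coeff (map f p) k ≡ f (coeff p k)
coeff-map f0 []      k       = ≡.sym f0
coeff-map f0 (a ∷ p) zero    = refl
coeff-map f0 (a ∷ p) (suc k) = coeff-map f0 p k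

coeff-neg : ∀ p k → coeff (map (λ a → ℤ.- a) p) k ≡ ℤ.- coeff p k
coeff-neg = coeff-map refl

-- Both `_*ᴾ_` and `conv` recurse by peeling the constant term off the first factor.
coeff-* : ∀ p q k → coeff (p *ᴾ q) k ≡ conv (coeff p) (coeff q) k
coeff-* []      q k = ≡.sym (conv-zeroˡ (coeff q) k)
coeff-* (a ∷ p) q k = ≡.trans (coeff-+ (map (a ℤ.*_) q) (0ℤ ∷ p *ᴾ q) k)
  (≡.trans (cong (ℤ._+ _) (coeff-map (ℤ.*-zeroʳ a) q k)) (step k))
  where
  step : ∀ k → a ℤ.* coeff q k ℤ.+ coeff (0ℤ ∷ p *ᴾ q) k ≡ conv (coeff (a ∷ p)) (coeff q) k
  step zero    = ℤ.+-identityʳ _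
  -- Prepending `0ℤ` multiplies by the variable, so coefficient `suc k` of the second summand is
  -- coefficient `k` of `p *ᴾ q`.
  step (suc k) = cong (ℤ._+_ (a ℤ.* coeff q (suc k))) (coeff-* p q k)

-- The ring of integer polynomials

polynomialRing : Ring 0ℓ 0ℓ
polynomialRing = record
  { Carrier = Poly
  ; _≈_ = _≈ᴾ_
  ; _+_ = _+ᴾ_
  ; _*_ = _*ᴾ_
  ; -_  = map (λ a → ℤ.- a)
  ; 0#  = []
  ; 1#  = 1ℤ ∷ []
  ; isRing = record
    { +-isAbelianGroup = record
      { isGroup = record
        { isMonoid = record
          { isSemigroup = record
            { isMagma = record
              { isEquivalence = record
                { refl  = λ _ → refl
                ; sym   = λ p≈q k → ≡.sym (p≈q k)
                ; trans = λ p≈q q≈r k → ≡.trans (p≈q k) (q≈r k)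
                }
              ; ∙-cong = λ {p} {p′} {q} {q′} p≈p′ q≈q′ k →
                  via (coeff-+ p q k) (cong₂ ℤ._+_ (p≈p′ k) (q≈q′ k)) (coeff-+ p′ q′ k)
              }
            ; assoc = λ p q r k →
                via (≡.trans (coeff-+ (p +ᴾ q) r k) (cong (ℤ._+ _) (coeff-+ p q k)))
                    (ℤ.+-assoc (coeff p k) (coeff q k) (coeff r k))
                    (≡.trans (coeff-+ p (q +ᴾ r) k) (cong (ℤ._+_ (coeff p k)) (coeff-+ q r k)))
            }
          ; identity = (λ p k → refl) ,
                       (λ p k → ≡.trans (coeff-+ p [] k) (ℤ.+-identityʳ _))
          }
        ; inverse =
            (λ p k → ≡.trans (coeff-+ (map (λ a → ℤ.- a) p) p k)
              (≡.trans (cong (ℤ._+ coeff p k) (coeff-neg p k)) (ℤ.+-inverseˡ (coeff p k)))) ,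
            (λ p k → ≡.trans (coeff-+ p (map (λ a → ℤ.- a) p) k)
              (≡.trans (cong (ℤ._+_ (coeff p k)) (coeff-neg p k)) (ℤ.+-inverseʳ (coeff p k))))
        ; ⁻¹-cong = λ {p} {q} p≈q k →
            via (coeff-neg p k) (cong (λ a → ℤ.- a) (p≈q k)) (coeff-neg q k)
        }
      ; comm = λ p q k →
          via (coeff-+ p q k) (ℤ.+-comm (coeff p k) (coeff q k)) (coeff-+ q p k)
      }
    ; *-cong = λ {p} {p′} {q} {q′} p≈p′ q≈q′ k →
        via (coeff-* p q k) (conv-cong p≈p′ q≈q′ k) (coeff-* p′ q′ k)
    ; *-assoc = λ p q r k →
        via (≡.trans (coeff-* (p *ᴾ q) r k) (conv-cong (coeff-* p q) (λ _ → refl) k))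
            (conv-assoc (coeff p) (coeff q) (coeff r) k)
            (≡.trans (coeff-* p (q *ᴾ r) k) (conv-cong (λ _ → refl) (coeff-* q r) k))
    ; *-identity =
        (λ p k → ≡.trans (coeff-* (1ℤ ∷ []) p k) (conv-identityˡ (coeff p) k)) ,
        (λ p k → ≡.trans (coeff-* p (1ℤ ∷ []) k) (conv-identityʳ (coeff p) k))
    ; distrib =
        (λ p q r k →
          via (≡.trans (coeff-* p (q +ᴾ r) k) (conv-cong (λ _ → refl) (coeff-+ q r) k))
              (conv-distribˡ (coeff p) (coeff q) (coeff r) k)
              (≡.trans (coeff-+ (p *ᴾ q) (p *ᴾ r) k)
                (cong₂ ℤ._+_ (coeff-* p q k) (coeff-* p r k)))) ,
        (λ p q r k →
          via (≡.trans (coeff-* (q +ᴾ r) p k) (conv-cong (coeff-+ q r) (λ _ → refl) k))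
              (conv-distribʳ (coeff q) (coeff r) (coeff p) k)
              (≡.trans (coeff-+ (q *ᴾ p) (r *ᴾ p) k)
                (cong₂ ℤ._+_ (coeff-* q p k) (coeff-* r p k))))
    }
  }
  where
  -- The outer equations pass from polynomials to integers or coefficient sequences, and the middle
  -- one is the law that holds there.
  via : ∀ {a b c d : ℤ} → a ≡ b → b ≡ c → d ≡ c → a ≡ d
  via a≡b b≡c d≡c = ≡.trans a≡b (≡.trans b≡c (≡.sym d≡c))

-- Subsets with a prepended element

zero∉outside∷ : {S : Subset n} → ¬ (zero ∈ outside ∷ S)
zero∉outside∷ ()

Nonempty-outside∷-⇔ : {S : Subset n} → Nonempty S ⇔ Nonempty (outside ∷ S)
Nonempty-outside∷-⇔ =
  mk⇔ (λ (i , i∈S) → suc i , there i∈S) (λ { (suc i , there i∈S) → i , i∈S })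

-- Containing the head makes a set non-empty, so `W` itself ranges over all subsets of `S`, the
-- empty one included.
Nonempty-⊆-inside∷-⇔ : {W S : Subset n} →
  W ⊆ S ⇔ (inside ∷ W ⊆ inside ∷ S × Nonempty (inside ∷ W))
Nonempty-⊆-inside∷-⇔ {W = W} {S} = mk⇔ to′ from′
  where
  to′ : W ⊆ S → inside ∷ W ⊆ inside ∷ S × Nonempty (inside ∷ W)
  to′ W⊆S = in⊆in W⊆S , zero , here

  from′ : inside ∷ W ⊆ inside ∷ S × Nonempty (inside ∷ W) → W ⊆ S
  from′ (W⊆S , _) = drop-∷-⊆ W⊆S

⊆-∩⁺ : {W S T : Subset n} → W ⊆ S → W ⊆ T → W ⊆ S ∩ T
⊆-∩⁺ W⊆S W⊆T i∈W = x∈p∩q⁺ (W⊆S i∈W , W⊆T i∈W)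

-- Neighbourhoods

module _ (G : Graph n) where
  open Graph G

  ∈-neighbours-⇔ : ∀ {u v} → u ∈ neighbours G v ⇔ u ~ v
  ∈-neighbours-⇔ {u} {v} = mk⇔ to′ from′
    where
    to′ : u ∈ neighbours G v → u ~ v
    -- The equation says that `does (u ~? v)` is true; abstracting it together with the decision
    -- makes the `no` case absurd.
    to′ u∈N with u ~? v | ≡.trans (≡.sym (lookup∘tabulate (λ w → does (w ~? v)) u)) ([]=⇒lookup u∈N)
    ... | yes u~v | _  = u~v
    ... | no  _   | ()
    from′ : u ~ v → u ∈ neighbours G v
    from′ u~v = lookup⇒[]= u _ (≡.trans (lookup∘tabulate _ u) (dec-true (u ~? v) u~v))

  ∈-⋂-neighbours-⇔ : ∀ {u} ws → u ∈ ⋂ (map (neighbours G) ws) ⇔ All (u ~_) ws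
  ∈-⋂-neighbours-⇔ []       = mk⇔ (λ _ → []) (λ _ → ∈⊤)
  ∈-⋂-neighbours-⇔ (w ∷ ws) = mk⇔
    (λ u∈ → let u∈N , u∈⋂ = x∈p∩q⁻ _ _ u∈ in
      to ∈-neighbours-⇔ u∈N ∷ to (∈-⋂-neighbours-⇔ ws) u∈⋂)
    (λ { (u~w ∷ u~ws) → x∈p∩q⁺ (from ∈-neighbours-⇔ u~w , from (∈-⋂-neighbours-⇔ ws) u~ws) })

  ∈-commonNeighbours⁺ : ∀ {u W} → (∀ {w} → w ∈ W → u ~ w) → u ∈ commonNeighbours G W
  ∈-commonNeighbours⁺ {W = W} u~W = from (∈-⋂-neighbours-⇔ _)
    (All.tabulate λ w∈ → u~W (proj₂ (∈-filter⁻ (_∈? W) {xs = allFin _} w∈)))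

  ∈-commonNeighbours⁻ : ∀ {u w W} → u ∈ commonNeighbours G W → w ∈ W → u ~ w
  ∈-commonNeighbours⁻ {W = W} u∈ w∈W =
    All.lookup (to (∈-⋂-neighbours-⇔ _) u∈) (∈-filter⁺ (_∈? W) (∈-allFin _) w∈W)

  -- Both inclusions say that every vertex of `A` is adjacent to every vertex of `W`. This symmetry
  -- is what allows the sums over `A` and `W` to be interchanged.
  ⊆-commonNeighbours-sym : ∀ {A W} → A ⊆ commonNeighbours G W → W ⊆ commonNeighbours G A
  ⊆-commonNeighbours-sym A⊆ w∈W =
    ∈-commonNeighbours⁺ λ a∈A → sym (∈-commonNeighbours⁻ (A⊆ a∈A) w∈W)

  ⊆-neighbours⁺ : ∀ {A v} → v ∈ commonNeighbours G A → A ⊆ neighbours G v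
  ⊆-neighbours⁺ v∈ a∈A = from ∈-neighbours-⇔ (sym (∈-commonNeighbours⁻ v∈ a∈A))

  ⊆-neighbours⁻ : ∀ {A v} → A ⊆ neighbours G v → v ∈ commonNeighbours G A
  ⊆-neighbours⁻ A⊆N = ∈-commonNeighbours⁺ λ a∈A → sym (to ∈-neighbours-⇔ (A⊆N a∈A))

  -- The vertices whose neighbourhood contains `A` are exactly the common neighbours of `A`.
  NeighbourhoodComplex-⇔ : ∀ {A} → NeighbourhoodComplex G A ⇔ Nonempty (commonNeighbours G A)
  NeighbourhoodComplex-⇔ = mk⇔
    (λ (v , A⊆N) → v , ⊆-neighbours⁻ A⊆N)
    (λ (v , v∈) → v , ⊆-neighbours⁺ v∈)

-- Faces of the graph with the added vertex

module _ (G : Graph n) (U : Subset n) where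

  private
    G′ = addVertex G U

  -- Among old vertices, an old vertex keeps its neighbourhood, and the new vertex has neighbourhood
  -- `U`. Requiring in the second case that `A` has no common neighbour makes the alternatives
  -- disjoint, so their contributions add.
  outside∷-face-⇔ : Nonempty U → ∀ {A} →
    NeighbourhoodComplex G′ (outside ∷ A) ⇔
      (NeighbourhoodComplex G A ⊎ ((A ⊆ U × Nonempty A) × ¬ Nonempty (commonNeighbours G A)))
  outside∷-face-⇔ (u , u∈U) {A} = mk⇔ to′ from′
    where
    to′ : NeighbourhoodComplex G′ (outside ∷ A) →
      NeighbourhoodComplex G A ⊎ ((A ⊆ U × Nonempty A) × ¬ Nonempty (commonNeighbours G A))
    to′ (suc v , A⊆N) = inj₁ (v , drop-∷-⊆ A⊆N)
    to′ (zero  , A⊆N) with nonempty? (commonNeighbours G A) | nonempty? A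
    ... | yes ne | _       = inj₁ (from (NeighbourhoodComplex-⇔ G) ne)
    ... | no ¬ne | yes A≠∅ =
      inj₂ (((λ a∈A → to (∈-neighbours-⇔ G′ {v = zero}) (A⊆N (there a∈A))) , A≠∅) , ¬ne)
    -- Every vertex is vacuously a common neighbour of the empty set, so the given element `u` of
    -- `U` contradicts `¬ne`.
    ... | no ¬ne | no  A=∅ =
      contradiction (u , ∈-commonNeighbours⁺ G λ a∈A → contradiction (_ , a∈A) A=∅) ¬ne

    from′ : NeighbourhoodComplex G A ⊎ ((A ⊆ U × Nonempty A) × ¬ Nonempty (commonNeighbours G A)) →
      NeighbourhoodComplex G′ (outside ∷ A)
    from′ (inj₁ (v , A⊆N)) = suc v , out⊆ A⊆N
    from′ (inj₂ ((A⊆U , _) , _)) =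
      zero , λ { (there a∈A) → from (∈-neighbours-⇔ G′ {v = zero}) (A⊆U a∈A) }

  -- The new vertex is not adjacent to itself, so the vertex witnessing such a face is an old one;
  -- it is adjacent to the new vertex exactly when it lies in `U`.
  inside∷-face-⇔ : ∀ {A} →
    NeighbourhoodComplex G′ (inside ∷ A) ⇔ Nonempty (U ∩ commonNeighbours G A)
  inside∷-face-⇔ {A} = mk⇔ to′ from′
    where
    to′ : NeighbourhoodComplex G′ (inside ∷ A) → Nonempty (U ∩ commonNeighbours G A)
    to′ (zero  , A⊆N) = contradiction (to (∈-neighbours-⇔ G′ {zero} {zero}) (A⊆N here)) λ ()
    to′ (suc v , A⊆N) =
      v , x∈p∩q⁺ (to (∈-neighbours-⇔ G′ {zero} {suc v}) (A⊆N here)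
                 , ⊆-neighbours⁻ G (drop-∷-⊆ A⊆N))

    from′ : Nonempty (U ∩ commonNeighbours G A) → NeighbourhoodComplex G′ (inside ∷ A)
    from′ (v , v∈) = suc v , λ
      { here        → from (∈-neighbours-⇔ G′ {zero} {suc v}) v∈U
      ; (there a∈A) → there (⊆-neighbours⁺ G v∈CN a∈A) }
      where
      v∈U  = proj₁ (x∈p∩q⁻ U _ v∈)
      v∈CN = proj₂ (x∈p∩q⁻ U _ v∈)

  -- For fixed `A`, the admissible `W` become the non-empty subsets of one set depending only on
  -- `A`, the form to which `euler` applies.
  ⊆-U-commonNeighbours-⇔ : ∀ {A W} →
    ((W ⊆ U × Nonempty W) × A ⊆ commonNeighbours G W) ⇔
    (W ⊆ U ∩ commonNeighbours G A × Nonempty W)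
  ⊆-U-commonNeighbours-⇔ {A} {W} = mk⇔ to′ from′
    where
    to′ : (W ⊆ U × Nonempty W) × A ⊆ commonNeighbours G W →
      W ⊆ U ∩ commonNeighbours G A × Nonempty W
    to′ ((W⊆U , W≠∅) , A⊆N) = ⊆-∩⁺ W⊆U (⊆-commonNeighbours-sym G A⊆N) , W≠∅

    from′ : W ⊆ U ∩ commonNeighbours G A × Nonempty W →
      (W ⊆ U × Nonempty W) × A ⊆ commonNeighbours G W
    from′ (W⊆ , W≠∅) =
      (⊆-trans W⊆ (p∩q⊆p U _) , W≠∅) , ⊆-commonNeighbours-sym G (⊆-trans W⊆ (p∩q⊆q U _))

-- Sums over families of subsets

module Sums {c ℓ} (R : Ring c ℓ) where

  open Ring R hiding (zero; refl; sym) renaming (Carrier to C)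
  open Ring R using () renaming (refl to ≈-refl; sym to ≈-sym)
  open RawSemiringDefinitions (Semiring.rawSemiring semiring) using (_^_)
  open RingProperties R using (-1*x≈-x; -‿involutive)
  open CommutativeSemigroupProperties (CommutativeMonoid.commutativeSemigroup +-commutativeMonoid)
    using (interchange; xy∙z≈xz∙y)
  open SetoidReasoning setoid

  private
    variable
      f g : A → C

  ∑ : List A → (A → C) → C
  ∑ as f = foldr _+_ 0# (map f as)

  ∑-cong : (as : List A) → (∀ a → f a ≈ g a) → ∑ as f ≈ ∑ as g
  ∑-cong []       f≈g = ≈-refl
  ∑-cong (a ∷ as) f≈g = +-cong (f≈g a) (∑-cong as f≈g)

  ∑-++ : (as bs : List A) → ∑ (as ++ bs) f ≈ ∑ as f + ∑ bs f
  ∑-++ []       bs = ≈-sym (+-identityˡ _)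
  ∑-++ (a ∷ as) bs = trans (+-congˡ (∑-++ as bs)) (≈-sym (+-assoc _ _ _))

  ∑-map : (h : A → B) (as : List A) → ∑ (map h as) f ≈ ∑ as (f ∘ h)
  ∑-map h []       = ≈-refl
  ∑-map h (a ∷ as) = +-congˡ (∑-map h as)

  ∑-zero : (as : List A) → ∑ as (λ _ → 0#) ≈ 0#
  ∑-zero []       = ≈-refl
  ∑-zero (a ∷ as) = trans (+-identityˡ _) (∑-zero as)

  ∑-distrib-+ : (as : List A) → ∑ as (λ a → f a + g a) ≈ ∑ as f + ∑ as g
  ∑-distrib-+ []       = ≈-sym (+-identityˡ _)
  ∑-distrib-+ (a ∷ as) = trans (+-congˡ (∑-distrib-+ as)) (interchange _ _ _ _)

  ∑-swap : (as : List A) (bs : List B) {h : A → B → C} →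
    ∑ as (λ a → ∑ bs (h a)) ≈ ∑ bs (λ b → ∑ as (λ a → h a b))
  ∑-swap []       bs = ≈-sym (∑-zero bs)
  ∑-swap (a ∷ as) bs = trans (+-congˡ (∑-swap as bs)) (≈-sym (∑-distrib-+ bs))

  *-distribˡ-∑ : (y : C) (as : List A) → y * ∑ as f ≈ ∑ as (λ a → y * f a)
  *-distribˡ-∑ y []       = zeroʳ y
  *-distribˡ-∑ y (a ∷ as) = trans (distribˡ y _ _) (+-congˡ (*-distribˡ-∑ y as))

  *-distribʳ-∑ : (y : C) (as : List A) → ∑ as f * y ≈ ∑ as (λ a → f a * y)
  *-distribʳ-∑ y []       = zeroˡ y
  *-distribʳ-∑ y (a ∷ as) = trans (distribʳ y _ _) (+-congˡ (*-distribʳ-∑ y as))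

  -- An Iverson bracket times `y`. Branching on `does` makes it agree definitionally with `A-term`
  -- and lets decisions of equivalent propositions be exchanged.
  when : Dec P → C → C
  when P? y = if does P? then y else 0#

  when-⇔ : P ⇔ Q → (P? : Dec P) (Q? : Dec Q) {y : C} → when P? y ≈ when Q? y
  when-⇔ P⇔Q P? Q? {y} = reflexive (cong (if_then y else 0#) (does-⇔ P⇔Q P? Q?))

  when-true : (P? : Dec P) → P → {y : C} → when P? y ≈ y
  when-true P? p {y} = reflexive (cong (if_then y else 0#) (dec-true P? p))

  when-false : (P? : Dec P) → ¬ P → {y : C} → when P? y ≈ 0#
  when-false P? ¬p {y} = reflexive (cong (if_then y else 0#) (dec-false P? ¬p))

  when-cong : (P? : Dec P) {y z : C} → y ≈ z → when P? y ≈ when P? z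
  when-cong (yes _) y≈z = y≈z
  when-cong (no _)  y≈z = ≈-refl

  when-× : (P? : Dec P) (Q? : Dec Q) {y : C} → when P? (when Q? y) ≈ when (P? ×-dec Q?) y
  when-× (yes _) (yes _) = ≈-refl
  when-× (yes _) (no _)  = ≈-refl
  when-× (no _)  _       = ≈-refl

  -- Exclusivity rules out the case in which the right side would count `y` twice.
  when-⊎ : S ⇔ (P ⊎ Q) → ¬ (P × Q) → (S? : Dec S) (P? : Dec P) (Q? : Dec Q) {y : C} →
    when S? y ≈ when P? y + when Q? y
  when-⊎ S⇔ ¬pq S? (yes p) (yes q) = contradiction (p , q) ¬pq
  when-⊎ S⇔ ¬pq S? (yes p) (no _)  =
    trans (when-true S? (from S⇔ (inj₁ p))) (≈-sym (+-identityʳ _))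
  when-⊎ S⇔ ¬pq S? (no _)  (yes q) =
    trans (when-true S? (from S⇔ (inj₂ q))) (≈-sym (+-identityˡ _))
  when-⊎ S⇔ ¬pq S? (no ¬p) (no ¬q) =
    trans (when-false S? ([ ¬p , ¬q ] ∘ to S⇔)) (≈-sym (+-identityˡ _))

  *-when : (P? : Dec P) (y : C) {z : C} → y * when P? z ≈ when P? (y * z)
  *-when (yes _) y = ≈-refl
  *-when (no _)  y = zeroʳ y

  when-* : (P? : Dec P) {y : C} (z : C) → when P? y * z ≈ when P? (y * z)
  when-* (yes _) z = ≈-refl
  when-* (no _)  z = zeroˡ z

  when-∑ : (P? : Dec P) (as : List A) → when P? (∑ as f) ≈ ∑ as (λ a → when P? (f a))
  when-∑ (yes _) as = ≈-refl
  when-∑ (no _)  as = ≈-sym (∑-zero as)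

  -- Moving the condition into the summand puts all sums over the same index list, where they can be
  -- compared, added and interchanged.
  ∑-filter : {P : Pred A p} (P? : Decidable P) (as : List A) →
    ∑ (filter P? as) f ≈ ∑ as (λ a → when (P? a) (f a))
  ∑-filter P? []       = ≈-refl
  ∑-filter P? (a ∷ as) with P? a
  ... | yes _ = +-congˡ (∑-filter P? as)
  ... | no  _ = trans (∑-filter P? as) (≈-sym (+-identityˡ _))

  -- Sums over all subsets and Euler's identity

  ∑-subsets-suc : (f : Subset (suc n) → C) →
    ∑ (subsets (suc n)) f ≈
      ∑ (subsets n) (λ A → f (outside ∷ A)) + ∑ (subsets n) (λ A → f (inside ∷ A))
  ∑-subsets-suc {n} f = trans (∑-++ (map (outside ∷_) (subsets n)) _)
    (+-cong (∑-map _ (subsets n)) (∑-map _ (subsets n)))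

  ∑-subsets-outside : {P : Subset (suc n) → Set} (P? : Decidable P) (f : Subset (suc n) → C) →
    (∀ W → ¬ P (inside ∷ W)) →
    ∑ (subsets (suc n)) (λ W → when (P? W) (f W)) ≈
      ∑ (subsets n) (λ W → when (P? (outside ∷ W)) (f (outside ∷ W)))
  ∑-subsets-outside {n} P? f ¬P = begin
    ∑ (subsets (suc n)) (λ W → when (P? W) (f W))
      ≈⟨ ∑-subsets-suc (λ W → when (P? W) (f W)) ⟩
    _ ≈⟨ +-congˡ (∑-cong (subsets n) λ W → when-false (P? (inside ∷ W)) (¬P W)) ⟩
    _ ≈⟨ +-congˡ (∑-zero (subsets n)) ⟩
    _ ≈⟨ +-identityʳ _ ⟩
    _ ∎

  -- The binomial theorem: each element of `S` contributes a factor `1#` when left out and `y` when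
  -- taken. It is applied with `y` equal to `x` and to `- 1#`.
  ∑-^-subsets : (y : C) (S : Subset n) →
    ∑ (subsets n) (λ A → when (A ⊆? S) (y ^ ∣ A ∣)) ≈ (1# + y) ^ ∣ S ∣
  ∑-^-subsets y [] = +-identityʳ 1#
  ∑-^-subsets {suc n} y (outside ∷ S) = begin
    ∑ (subsets (suc n)) (λ A → when (A ⊆? outside ∷ S) (y ^ ∣ A ∣))
      ≈⟨ ∑-subsets-outside (_⊆? outside ∷ S) (λ A → y ^ ∣ A ∣) (λ A A⊆S → zero∉outside∷ (A⊆S here)) ⟩
    ∑ (subsets n) (λ A → when (outside ∷ A ⊆? outside ∷ S) (y ^ ∣ A ∣))
      ≈⟨ ∑-cong (subsets n) (λ A → when-⇔ out⊆-⇔ (A ⊆? S) (outside ∷ A ⊆? outside ∷ S)) ⟨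
    ∑ (subsets n) (λ A → when (A ⊆? S) (y ^ ∣ A ∣))
      ≈⟨ ∑-^-subsets y S ⟩
    (1# + y) ^ ∣ S ∣ ∎
  ∑-^-subsets {suc n} y (inside ∷ S) = begin
    ∑ (subsets (suc n)) (λ A → when (A ⊆? inside ∷ S) (y ^ ∣ A ∣))
      ≈⟨ ∑-subsets-suc (λ A → when (A ⊆? inside ∷ S) (y ^ ∣ A ∣)) ⟩
    ∑ (subsets n) (λ A → when (outside ∷ A ⊆? inside ∷ S) (y ^ ∣ A ∣)) +
    ∑ (subsets n) (λ A → when (inside ∷ A ⊆? inside ∷ S) (y * y ^ ∣ A ∣))
      ≈⟨ +-cong
           (∑-cong (subsets n) λ A → when-⇔ out⊆-⇔ (A ⊆? S) (outside ∷ A ⊆? inside ∷ S))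
           (∑-cong (subsets n) λ A → trans (*-when (A ⊆? S) y)
             (when-⇔ in⊆in-⇔ (A ⊆? S) (inside ∷ A ⊆? inside ∷ S))) ⟨
    ∑ (subsets n) (λ A → when (A ⊆? S) (y ^ ∣ A ∣)) +
    ∑ (subsets n) (λ A → y * when (A ⊆? S) (y ^ ∣ A ∣))
      ≈⟨ +-cong (≈-sym (*-identityˡ _)) (≈-sym (*-distribˡ-∑ y (subsets n))) ⟩
    1# * ∑ (subsets n) (λ A → when (A ⊆? S) (y ^ ∣ A ∣)) +
    y * ∑ (subsets n) (λ A → when (A ⊆? S) (y ^ ∣ A ∣))
      ≈⟨ distribʳ _ 1# y ⟨
    (1# + y) * ∑ (subsets n) (λ A → when (A ⊆? S) (y ^ ∣ A ∣))
      ≈⟨ *-congˡ (∑-^-subsets y S) ⟩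
    (1# + y) * (1# + y) ^ ∣ S ∣ ∎

  -- The power has base zero, so it is `1#` for empty `S` and vanishes otherwise, which complements
  -- the bracket.
  when-Nonempty+0^ : (S : Subset n) → when (nonempty? S) 1# + (1# + - 1#) ^ ∣ S ∣ ≈ 1#
  when-Nonempty+0^ []            = +-identityˡ 1#
  when-Nonempty+0^ (outside ∷ S) = trans
    (+-congʳ (≈-sym (when-⇔ Nonempty-outside∷-⇔ (nonempty? S) (nonempty? (outside ∷ S)))))
    (when-Nonempty+0^ S)
  when-Nonempty+0^ (inside ∷ S)  = begin
    when (nonempty? (inside ∷ S)) 1# + (1# + - 1#) * (1# + - 1#) ^ ∣ S ∣
      ≈⟨ +-cong (when-true (nonempty? (inside ∷ S)) (zero , here))
                (trans (*-congʳ (-‿inverseʳ 1#)) (zeroˡ _)) ⟩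
    1# + 0# ≈⟨ +-identityʳ 1# ⟩
    1#      ∎

  -- With `k` the size of `W`, the left side is the sign attached to `inside ∷ W`; its two extra
  -- factors cancel.
  -1^2+n : ∀ k → (- 1#) ^ (suc k ℕ.+ 1) ≈ (- 1#) ^ k
  -1^2+n k rewrite ℕ.+-comm k 1 = begin
    - 1# * (- 1# * (- 1#) ^ k) ≈⟨ *-congˡ (-1*x≈-x _) ⟩
    - 1# * - ((- 1#) ^ k)      ≈⟨ -1*x≈-x _ ⟩
    - - ((- 1#) ^ k)           ≈⟨ -‿involutive _ ⟩
    (- 1#) ^ k                 ∎

  -- Induction on `S`. If the head belongs to `S`, the sets `W` avoiding it give the identity for
  -- the tail, and those containing it give the signed count of all subsets of the tail, a power of
  -- zero; together they make `1#`.
  euler : (S : Subset n) →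
    ∑ (subsets n) (λ W → when ((W ⊆? S) ×-dec nonempty? W) ((- 1#) ^ (∣ W ∣ ℕ.+ 1))) ≈
      when (nonempty? S) 1#
  euler [] = +-identityʳ 0#
  euler {suc n} (outside ∷ S) = begin
    ∑ (subsets (suc n)) (λ W → when ((W ⊆? outside ∷ S) ×-dec nonempty? W) ((- 1#) ^ (∣ W ∣ ℕ.+ 1)))
      ≈⟨ ∑-subsets-outside (λ W → (W ⊆? outside ∷ S) ×-dec nonempty? W)
           (λ W → (- 1#) ^ (∣ W ∣ ℕ.+ 1)) (λ W (W⊆S , _) → zero∉outside∷ (W⊆S here)) ⟩
    _ ≈⟨ ∑-cong (subsets n) (λ W → when-⇔ (out⊆-⇔ ×-⇔ Nonempty-outside∷-⇔)
           ((W ⊆? S) ×-dec nonempty? W)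
           ((outside ∷ W ⊆? outside ∷ S) ×-dec nonempty? (outside ∷ W))) ⟨
    ∑ (subsets n) (λ W → when ((W ⊆? S) ×-dec nonempty? W) ((- 1#) ^ (∣ W ∣ ℕ.+ 1)))
      ≈⟨ euler S ⟩
    when (nonempty? S) 1#
      ≈⟨ when-⇔ Nonempty-outside∷-⇔ (nonempty? S) (nonempty? (outside ∷ S)) ⟩
    when (nonempty? (outside ∷ S)) 1# ∎
  euler {suc n} (inside ∷ S) = begin
    ∑ (subsets (suc n)) (λ W → when ((W ⊆? inside ∷ S) ×-dec nonempty? W) ((- 1#) ^ (∣ W ∣ ℕ.+ 1)))
      ≈⟨ ∑-subsets-suc (λ W → when ((W ⊆? inside ∷ S) ×-dec nonempty? W) ((- 1#) ^ (∣ W ∣ ℕ.+ 1))) ⟩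
    _ ≈⟨ +-cong
           (∑-cong (subsets n) λ W → when-⇔ (out⊆-⇔ ×-⇔ Nonempty-outside∷-⇔)
             ((W ⊆? S) ×-dec nonempty? W)
             ((outside ∷ W ⊆? inside ∷ S) ×-dec nonempty? (outside ∷ W)))
           (∑-cong (subsets n) λ W → trans
             (when-cong (W ⊆? S) (≈-sym (-1^2+n ∣ W ∣)))
             (when-⇔ Nonempty-⊆-inside∷-⇔ (W ⊆? S)
               ((inside ∷ W ⊆? inside ∷ S) ×-dec nonempty? (inside ∷ W)))) ⟨
    ∑ (subsets n) (λ W → when ((W ⊆? S) ×-dec nonempty? W) ((- 1#) ^ (∣ W ∣ ℕ.+ 1))) +
    ∑ (subsets n) (λ W → when (W ⊆? S) ((- 1#) ^ ∣ W ∣))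
      ≈⟨ +-cong (euler S) (∑-^-subsets (- 1#) S) ⟩
    when (nonempty? S) 1# + (1# + - 1#) ^ ∣ S ∣
      ≈⟨ when-Nonempty+0^ S ⟩
    1#
      ≈⟨ when-true (nonempty? (inside ∷ S)) (zero , here) ⟨
    when (nonempty? (inside ∷ S)) 1# ∎

  -- Face sums of the graph with the added vertex

  module _ (x : C) (G : Graph n) (U : Subset n) where

    private
      G′ = addVertex G U
      N  = commonNeighbours G

    ∑-faces-outside : Nonempty U →
      ∑ (subsets n) (λ A → when (neighbourhoodComplex? G′ (outside ∷ A)) (x ^ ∣ A ∣)) ≈
        ∑ (filter (neighbourhoodComplex? G) (subsets n)) (λ A → x ^ ∣ A ∣) +
        ∑ (nonemptySubsetsOf U) (λ W → when (¬? (nonempty? (N W))) (x ^ ∣ W ∣))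
    ∑-faces-outside U≠∅ = begin
      ∑ (subsets n) (λ A → when (neighbourhoodComplex? G′ (outside ∷ A)) (x ^ ∣ A ∣))
        ≈⟨ ∑-cong (subsets n) split ⟩
      ∑ (subsets n) (λ A → when (neighbourhoodComplex? G A) (x ^ ∣ A ∣) +
        when ((A ⊆? U) ×-dec nonempty? A) (when (¬? (nonempty? (N A))) (x ^ ∣ A ∣)))
        ≈⟨ ∑-distrib-+ (subsets n) ⟩
      _ ≈⟨ +-cong (∑-filter (neighbourhoodComplex? G) (subsets n))
                  (∑-filter (λ W → (W ⊆? U) ×-dec nonempty? W) (subsets n)) ⟨
      _ ∎
      where
      split : ∀ A → when (neighbourhoodComplex? G′ (outside ∷ A)) (x ^ ∣ A ∣) ≈
        when (neighbourhoodComplex? G A) (x ^ ∣ A ∣) +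
        when ((A ⊆? U) ×-dec nonempty? A) (when (¬? (nonempty? (N A))) (x ^ ∣ A ∣))
      split A = trans
        (when-⊎ (outside∷-face-⇔ G U U≠∅)
          (λ (face , _ , N=∅) → N=∅ (to (NeighbourhoodComplex-⇔ G) face))
          (neighbourhoodComplex? G′ (outside ∷ A)) (neighbourhoodComplex? G A)
          (((A ⊆? U) ×-dec nonempty? A) ×-dec ¬? (nonempty? (N A))))
        -- The condition is nested so that its outer part becomes the filter of
        -- `nonemptySubsetsOf U` and its inner part the case distinction of `A-term`.
        (+-congˡ (≈-sym (when-× ((A ⊆? U) ×-dec nonempty? A) (¬? (nonempty? (N A))))))

    -- The weight `x * x ^ ∣ A ∣` is the unfolded power for `inside ∷ A`, which has one element more
    -- than `A`. The calculation runs from the signed sum back to the faces.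
    ∑-faces-inside :
      ∑ (subsets n) (λ A → when (neighbourhoodComplex? G′ (inside ∷ A)) (x * x ^ ∣ A ∣)) ≈
        ∑ (nonemptySubsetsOf U) (λ W → (- 1#) ^ (∣ W ∣ ℕ.+ 1) * (x * (1# + x) ^ ∣ N W ∣))
    ∑-faces-inside = ≈-sym (begin
      ∑ (nonemptySubsetsOf U) (λ W → sign W * (x * (1# + x) ^ ∣ N W ∣))
        ≈⟨ ∑-filter W? (subsets n) ⟩
      ∑ (subsets n) (λ W → when (W? W) (sign W * (x * (1# + x) ^ ∣ N W ∣)))
        ≈⟨ ∑-cong (subsets n) expand ⟩
      ∑ (subsets n) (λ W → ∑ (subsets n) λ A →
        when ((W ⊆? U ∩ N A) ×-dec nonempty? W) (sign W) * (x * x ^ ∣ A ∣))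
        ≈⟨ ∑-swap (subsets n) (subsets n) ⟩
      ∑ (subsets n) (λ A → ∑ (subsets n) λ W →
        when ((W ⊆? U ∩ N A) ×-dec nonempty? W) (sign W) * (x * x ^ ∣ A ∣))
        ≈⟨ ∑-cong (subsets n) collapse ⟩
      ∑ (subsets n) (λ A → when (neighbourhoodComplex? G′ (inside ∷ A)) (x * x ^ ∣ A ∣)) ∎)
      where
      W? : Decidable (λ W → W ⊆ U × Nonempty W)
      W? W = (W ⊆? U) ×-dec nonempty? W

      sign : Subset n → C
      sign W = (- 1#) ^ (∣ W ∣ ℕ.+ 1)

      -- The power of `1# + x` is expanded over the subsets `A` of `N W`. The condition is then
      -- attached to the sign alone, leaving a factor that depends only on `A`.
      expand : ∀ W → when (W? W) (sign W * (x * (1# + x) ^ ∣ N W ∣)) ≈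
        ∑ (subsets n) λ A →
          when ((W ⊆? U ∩ N A) ×-dec nonempty? W) (sign W) * (x * x ^ ∣ A ∣)
      expand W = begin
        when (W? W) (sign W * (x * (1# + x) ^ ∣ N W ∣))
          ≈⟨ when-cong (W? W) (*-congˡ (*-congˡ (∑-^-subsets x (N W)))) ⟨
        when (W? W) (sign W * (x * ∑ (subsets n) λ A → when (A ⊆? N W) (x ^ ∣ A ∣)))
          ≈⟨ when-cong (W? W) (trans (*-congˡ (*-distribˡ-∑ x (subsets n)))
                                     (*-distribˡ-∑ (sign W) (subsets n))) ⟩
        when (W? W) (∑ (subsets n) λ A → sign W * (x * when (A ⊆? N W) (x ^ ∣ A ∣)))
          ≈⟨ when-∑ (W? W) (subsets n) ⟩
        ∑ (subsets n) (λ A → when (W? W) (sign W * (x * when (A ⊆? N W) (x ^ ∣ A ∣))))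
          ≈⟨ ∑-cong (subsets n) (λ A → begin
               when (W? W) (sign W * (x * when (A ⊆? N W) (x ^ ∣ A ∣)))
                 ≈⟨ when-cong (W? W) (trans (*-congˡ (*-when (A ⊆? N W) x)) (*-when (A ⊆? N W) (sign W))) ⟩
               when (W? W) (when (A ⊆? N W) (sign W * (x * x ^ ∣ A ∣)))
                 ≈⟨ when-× (W? W) (A ⊆? N W) ⟩
               when (W? W ×-dec (A ⊆? N W)) (sign W * (x * x ^ ∣ A ∣))
                 ≈⟨ when-⇔ (⊆-U-commonNeighbours-⇔ G U) (W? W ×-dec (A ⊆? N W))
                      ((W ⊆? U ∩ N A) ×-dec nonempty? W) ⟩
               when ((W ⊆? U ∩ N A) ×-dec nonempty? W) (sign W * (x * x ^ ∣ A ∣))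
                 ≈⟨ when-* ((W ⊆? U ∩ N A) ×-dec nonempty? W) _ ⟨
               when ((W ⊆? U ∩ N A) ×-dec nonempty? W) (sign W) * (x * x ^ ∣ A ∣) ∎) ⟩
        _ ∎

      -- The weight is constant in `W` and factors out; `euler` evaluates the remaining signed sum
      -- as the bracket deciding whether `inside ∷ A` is a face.
      collapse : ∀ A → (∑ (subsets n) λ W →
          when ((W ⊆? U ∩ N A) ×-dec nonempty? W) (sign W) * (x * x ^ ∣ A ∣)) ≈
        when (neighbourhoodComplex? G′ (inside ∷ A)) (x * x ^ ∣ A ∣)
      collapse A = begin
        ∑ (subsets n) (λ W → when ((W ⊆? U ∩ N A) ×-dec nonempty? W) (sign W) * (x * x ^ ∣ A ∣))
          ≈⟨ *-distribʳ-∑ (x * x ^ ∣ A ∣) (subsets n) ⟨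
        ∑ (subsets n) (λ W → when ((W ⊆? U ∩ N A) ×-dec nonempty? W) (sign W)) * (x * x ^ ∣ A ∣)
          ≈⟨ *-congʳ (euler (U ∩ N A)) ⟩
        when (nonempty? (U ∩ N A)) 1# * (x * x ^ ∣ A ∣)
          ≈⟨ when-* (nonempty? (U ∩ N A)) _ ⟩
        when (nonempty? (U ∩ N A)) (1# * (x * x ^ ∣ A ∣))
          ≈⟨ when-cong (nonempty? (U ∩ N A)) (*-identityˡ _) ⟩
        when (nonempty? (U ∩ N A)) (x * x ^ ∣ A ∣)
          ≈⟨ when-⇔ (inside∷-face-⇔ G U) (neighbourhoodComplex? G′ (inside ∷ A)) (nonempty? (U ∩ N A)) ⟨
        when (neighbourhoodComplex? G′ (inside ∷ A)) (x * x ^ ∣ A ∣) ∎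

    ∑-faces-addVertex : Nonempty U →
      ∑ (filter (neighbourhoodComplex? G′) (subsets (suc n))) (λ A → x ^ ∣ A ∣) ≈
        ∑ (filter (neighbourhoodComplex? G) (subsets n)) (λ A → x ^ ∣ A ∣)
        + ∑ (nonemptySubsetsOf U) (λ W → (- 1#) ^ (∣ W ∣ ℕ.+ 1) * (x * (1# + x) ^ ∣ N W ∣))
        + ∑ (nonemptySubsetsOf U) (λ W → when (¬? (nonempty? (N W))) (x ^ ∣ W ∣))
    ∑-faces-addVertex U≠∅ = begin
      ∑ (filter (neighbourhoodComplex? G′) (subsets (suc n))) (λ A → x ^ ∣ A ∣)
        ≈⟨ ∑-filter (neighbourhoodComplex? G′) (subsets (suc n)) ⟩
      ∑ (subsets (suc n)) (λ A → when (neighbourhoodComplex? G′ A) (x ^ ∣ A ∣))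
        ≈⟨ ∑-subsets-suc (λ A → when (neighbourhoodComplex? G′ A) (x ^ ∣ A ∣)) ⟩
      _ ≈⟨ +-cong (∑-faces-outside U≠∅) ∑-faces-inside ⟩
      -- The split by the new vertex yields the terms `A_W` before the signed sum, so the last two
      -- summands trade places.
      _ ≈⟨ xy∙z≈xz∙y _ _ _ ⟩
      _ ∎

open import Defs

theorem9 : ∀ {n : ℕ} (G : Graph n) (U : Subset n) → Nonempty U →
    neighbourhoodPolynomial (addVertex G U) ≈
    neighbourhoodPolynomial G
    + (∑[ W ∈ nonemptySubsetsOf U ]
    ((- 1#) ^ (∣ W ∣ ℕ.+ 1) * (x * (1# + x) ^ ∣ commonNeighbours G W ∣)))
    + (∑[ W ∈ nonemptySubsetsOf U ] A-term G W)
-- Over `polynomialRing` the generic sums, powers and brackets unfold to those in the definitions,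
-- so the generic identity has the required type.
theorem9 G U U≠∅ = Sums.∑-faces-addVertex polynomialRing x G U U≠∅
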